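{- There is an algorithm which, given a graph $G$, lists all rigid skeletons of $G$.
   Context: All graphs are finite, simple, undirected. A homomorphism $G\to H$ is a map $h:V(G)\to V(H)$ with $h(u)h(v)\in E(H)$ whenever $uv\in E(G)$; an embedding is an injective homomorphism; an endomorphism of $G$ is a homomorphism $G\to G$. $G\setminus X$ denotes $G$ with the vertex set $X$ deleted. Quotient: for a graph $K$ and $D\subseteq V(K)$ such that every vertex of $D$ has degree at most $2$ in $K$, $K/D$ has vertex set $V(K)\setminus D$, and distinct $u,v$ are adjacent iff $K$ has a path from $u$ to $v$ whose internal vertices all lie in $D$. A vertex $x\in D$ is associated with a vertex $v$ of $K/D$ if $x$ lies on a path in $K$ between $v$ and some $w\in D$ of degree $1$ in $K$ whose internal vertices are all in $D$; $x$ is associated with an edge $vw$ of $K/D$ if $x$ lies on a path in $K$ between $v$ and $w$ whose internal vertices are all in $D$. Frame: $F\subseteq V(G)$ is a frame for $G$ if every endomorphism $h$ of $G$ with $F\subseteq h(V(G))$ is surjective. Skeleton: a pair $(F,D)$ of subsets of $V(G)$ such that $F$ is a frame for $G$, $F\cap D=\emptyset$, and every $v\in D$ has at most $2$ neighbours in $V(G)\setminus F$. Below, "associated" refers to $K=G\setminus F$ and $K/D=(G\setminus F)/D$. Product graph $P=P(G,\mathcal S,H,\chi)$ for a skeleton $\mathcal S=(F,D)$, a graph $H$ and $\chi:V(H)\to V(G)\setminus(F\cup D)$: $V(P)=V_1\cup V_2\cup V_3\cup V_4$ where $V_1=\{(u,a)\mid u\in V(G)\setminus(F\cup D), a\in V(H),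 \chi(a)=u\}$; $V_2=\{(u,u)\mid u\in F$, or $u\in D$ is associated with no vertex and no edge of $(G\setminus F)/D\}$; $V_3=\{(u,\mathbf v_{u,a})\mid u\in D, a\in V(H), u$ is associated with the vertex $\chi(a)\}$; $V_4=\{(u,\mathbf v_{u,e})\mid u\in D, e=\{a,b\}\in E(H), u$ is associated with the edge $\{\chi(a),\chi(b)\}\}$, where all $\mathbf v_{u,a},\mathbf v_{u,e}$ are fresh elements. Edges (in all cases $uv\in E(G)$ is required): $(u,a)(v,b)$ for $(u,a),(v,b)\in V_1$ with $ab\in E(H)$; $(u,a)(v,v)$ for $(u,a)\in V_1$, $(v,v)\in V_2$; $(u,a)(v,\mathbf v_{v,a})$ for $(u,a)\in V_1$, $(v,\mathbf v_{v,a})\in V_3$; $(u,a)(v,\mathbf v_{v,e})$ for $(u,a)\in V_1$, $(v,\mathbf v_{v,e})\in V_4$ with $a\in e$; $(u,u)(v,v)$ for both in $V_2$; $(u,u)(v,z)$ for $(u,u)\in V_2$ and $(v,z)\in V_3\cup V_4$; $(u,\mathbf v_{u,a})(v,\mathbf v_{v,a})$ for both in $V_3$ (same $a$); $(u,\mathbf v_{u,e})(v,\mathbf v_{v,e})$ for both in $V_4$ (same $e$); no edges between $V_3$ and $V_4$. Rigid skeleton: a skeleton $\mathcal S=(F,D)$ of $G$ is rigid if for every graph $H$, every $\chi:V(H)\to V(G)\setminus(F\cup D)$ and every embedding $h$ from $G$ to $P(G,\mathcal S,H,\chi)$ we have $\{(u,u)\mid u\in F\}\subseteq h(V(G))$.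 -}

module Defs where

open import Data.Nat using (ℕ; _≤_)
open import Data.Bool using (Bool; true; false)
open import Data.Fin using (Fin; _<_)
open import Data.Fin.Subset using (Subset; _∈_; _∉_; ∁; _∩_; ∣_∣)
open import Data.Vec using (tabulate)
open import Data.List using (List; []; _∷_; _++_; [_])
import Data.List.Membership.Propositional as LM
open import Data.List.Relation.Unary.All using (All)
open import Data.List.Relation.Unary.Linked using (Linked)
open import Data.List.Relation.Unary.Unique.Propositional using (Unique)
open import Data.Product using (Σ; ∃; ∃-syntax; _×_; _,_)
open import Data.Sum using (_⊎_)
open import Data.Unit using (⊤)
open import Data.Empty using (⊥)
open import Relation.Nullary using (¬_)
open import Relation.Binary.PropositionalEquality using (_≡_)

record Graph (n : ℕ) : Set where
  field
    adj   : Fin n → Fin n → Bool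
    sym   : ∀ u v → adj u v ≡ adj v u
    irref : ∀ u → adj u u ≡ false
open Graph public

Adj : ∀ {n} → Graph n → Fin n → Fin n → Set
Adj G u v = adj G u v ≡ true

nbhd : ∀ {n} → Graph n → Fin n → Subset n
nbhd G v = tabulate (adj G v)

IsHom : ∀ {n m} → Graph n → Graph m → (Fin n → Fin m) → Set
IsHom G H h = ∀ u v → Adj G u v → Adj H (h u) (h v)

IsEndo : ∀ {n} → Graph n → (Fin n → Fin n) → Set
IsEndo G h = IsHom G G h

Surjective : ∀ {n} → (Fin n → Fin n) → Set
Surjective h = ∀ w → ∃[ v ] h v ≡ w

IsFrame : ∀ {n} → Graph n → Subset n → Set
IsFrame G F = ∀ h → IsEndo G h → (∀ u → u ∈ F → ∃[ v ] h v ≡ u) → Surjective h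

degK : ∀ {n} → Graph n → Subset n → Fin n → ℕ
degK G F x = ∣ nbhd G x ∩ ∁ F ∣

IsSkeleton : ∀ {n} → Graph n → Subset n → Subset n → Set
IsSkeleton G F D =
  IsFrame G F × (∀ u → u ∈ F → u ∉ D) × (∀ v → v ∈ D → degK G F v ≤ 2)

KAdj : ∀ {n} → Graph n → Subset n → Fin n → Fin n → Set
KAdj G F x y = Adj G x y × x ∉ F × y ∉ F

DPath : ∀ {n} → Graph n → Subset n → Subset n → Fin n → Fin n → List (Fin n) → Set
DPath G F D u v xs =
  Linked (KAdj G F) (u ∷ xs ++ [ v ]) × Unique (u ∷ xs ++ [ v ]) × All (_∈ D) xs

QVert : ∀ {n} → Subset n → Subset n → Fin n → Set
QVert F D v = v ∉ F × v ∉ D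

AssocV : ∀ {n} → Graph n → Subset n → Subset n → Fin n → Fin n → Set
AssocV G F D x v =
  x ∈ D × QVert F D v ×
  ∃[ w ] (w ∈ D × degK G F w ≡ 1 ×
          ∃[ xs ] (DPath G F D v w xs × x LM.∈ (v ∷ xs ++ [ w ])))

AssocE : ∀ {n} → Graph n → Subset n → Subset n → Fin n → Fin n → Fin n → Set
AssocE G F D x v w =
  x ∈ D × QVert F D v × QVert F D w ×
  ∃[ xs ] (DPath G F D v w xs × x LM.∈ (v ∷ xs ++ [ w ]))

AssocAnyEdge : ∀ {n} → Graph n → Subset n → Subset n → Fin n → Set
AssocAnyEdge G F D x = ∃[ v ] ∃[ w ] AssocE G F D x v w

AssocAnyVert : ∀ {n} → Graph n → Subset n → Subset n → Fin n → Set
AssocAnyVert G F D x = ∃[ v ] AssocV G F D x v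

-- raw vertex labels; validity is given by ValidP
--   v1 u a     ~ (u, a)
--   v2 u       ~ (u, u)
--   v3 u a     ~ (u, v_{u,a})
--   v4 u a b   ~ (u, v_{u,{a,b}})  with a < b (canonical representative)
data PV (n m : ℕ) : Set where
  v1 : Fin n → Fin m → PV n m
  v2 : Fin n → PV n m
  v3 : Fin n → Fin m → PV n m
  v4 : Fin n → Fin m → Fin m → PV n m

pfst : ∀ {n m} → PV n m → Fin n
pfst (v1 u _)   = u
pfst (v2 u)     = u
pfst (v3 u _)   = u
pfst (v4 u _ _) = u

module Product {n m : ℕ} (G : Graph n) (F D : Subset n) (H : Graph m)
               (χ : Fin m → Fin n) where

  ValidP : PV n m → Set
  ValidP (v1 u a)   = χ a ≡ u
  ValidP (v2 u)     = u ∈ F ⊎ (u ∈ D × ¬ AssocAnyVert G F D u × ¬ AssocAnyEdge G F D u)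
  ValidP (v3 u a)   = u ∈ D × AssocV G F D u (χ a)
  ValidP (v4 u a b) = a < b × Adj H a b × u ∈ D × AssocE G F D u (χ a) (χ b)

  PAdj' : PV n m → PV n m → Set
  PAdj' (v1 _ a)   (v1 _ b)   = Adj H a b
  PAdj' (v1 _ _)   (v2 _)     = ⊤
  PAdj' (v1 _ a)   (v3 _ b)   = a ≡ b
  PAdj' (v1 _ a)   (v4 _ b c) = a ≡ b ⊎ a ≡ c
  PAdj' (v2 _)     (v1 _ _)   = ⊤
  PAdj' (v2 _)     (v2 _)     = ⊤
  PAdj' (v2 _)     (v3 _ _)   = ⊤
  PAdj' (v2 _)     (v4 _ _ _) = ⊤
  PAdj' (v3 _ a)   (v1 _ b)   = b ≡ a
  PAdj' (v3 _ _)   (v2 _)     = ⊤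
  PAdj' (v3 _ a)   (v3 _ b)   = a ≡ b
  PAdj' (v3 _ _)   (v4 _ _ _) = ⊥
  PAdj' (v4 _ b c) (v1 _ a)   = a ≡ b ⊎ a ≡ c
  PAdj' (v4 _ _ _) (v2 _)     = ⊤
  PAdj' (v4 _ _ _) (v3 _ _)   = ⊥
  PAdj' (v4 _ a b) (v4 _ c d) = a ≡ c × b ≡ d

  PAdj : PV n m → PV n m → Set
  PAdj p q = Adj G (pfst p) (pfst q) × PAdj' p q

  IsEmbedding : (Fin n → PV n m) → Set
  IsEmbedding h =
    (∀ x → ValidP (h x)) ×
    (∀ x y → h x ≡ h y → x ≡ y) ×
    (∀ x y → Adj G x y → PAdj (h x) (h y))

IsRigidSkeleton : ∀ {n} → Graph n → Subset n → Subset n → Set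
IsRigidSkeleton {n} G F D =
  IsSkeleton G F D ×
  (∀ (m : ℕ) (H : Graph m) (χ : Fin m → Fin n) →
     (∀ a → QVert F D (χ a)) →
     (h : Fin n → PV n m) → Product.IsEmbedding G F D H χ h →
     ∀ u → u ∈ F → ∃[ x ] h x ≡ v2 u)

-- Deciding whether (F, D) is a skeleton is a finite search: the frame condition quantifies
-- over the maps V(G) → V(G), and association over paths in G \ F, whose length is at most
-- |V(G)|. Rigidity quantifies over all graphs H, but a vertex of P(G, S, H, χ) is built from
-- at most two vertices of H, so an embedding of G uses at most 2|V(G)| of them. When H is
-- larger, some vertex c of H is unused and the embedding factors through the product built
-- from H - c, which contains the same vertices (u, u). Hence rigidity need only be checked
-- for |V(H)| ≤ 2|V(G)|, again a finite search, and the rigid skeletons are obtained by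
-- filtering the list of all pairs of subsets.

module Submission where

open import Defs hiding (sym)
open import Level using (0ℓ)
open import Data.Nat as ℕ using (ℕ; zero; suc; z≤n; s≤s)
import Data.Nat.Properties as ℕ
open import Data.Fin as Fin using (Fin; zero; suc; punchIn; punchOut)
import Data.Fin.Properties as Fin
import Data.Fin.Subset as Subset
open import Data.Fin.Subset using (Subset)
open import Data.Fin.Subset.Properties using (_∈?_)
open import Data.Bool using (Bool; true; false; not; _∧_; _∨_)
import Data.Bool.Properties as Bool
open import Data.Maybe using (Maybe; just; nothing)
open import Data.Maybe.Properties using (just-injective) renaming (≡-dec to ≡-dec-Maybe)
open import Data.List as List using (List; []; _∷_; _++_; [_]; length; map; allFin; cartesianProduct)
import Data.List.Properties as List
open import Data.List.Membership.Propositional using (_∈_)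
open import Data.List.Membership.Propositional.Properties
  using (∈-allFin; ∈-cartesianProduct⁺; ∈-lookup; ∈-map⁺; ∈-++⁺ˡ; ∈-++⁺ʳ; ∈-filter⁺; ∈-filter⁻)
import Data.List.Membership.Setoid.Properties as Setoidₘ
import Data.List.Relation.Unary.All as All
open import Data.List.Relation.Unary.Any as Any using (here; there)
open import Data.List.Relation.Unary.Linked using (linked?)
import Data.List.Relation.Unary.AllPairs as AllPairs
open import Data.List.Relation.Unary.Unique.Propositional using (Unique)
import Data.List.Relation.Unary.Unique.DecPropositional as Unique
open import Data.List.Relation.Unary.Enumerates.Setoid using (IsEnumeration)
open import Data.List.Relation.Unary.Enumerates.Setoid.Properties using (cartesianProduct⁺)
open import Data.Vec using (tabulate; lookup)
open import Data.Vec.Properties using (tabulate-cong; tabulate∘lookup)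
open import Data.Vec.Functional as Vector using (Vector)
open import Data.Product using (Σ; ∃; ∃-syntax; _×_; _,_; proj₁; proj₂; uncurry)
open import Data.Product.Relation.Binary.Pointwise.NonDependent using (_×ₛ_)
import Data.Product.Properties as Σ
open import Data.Sum using (_⊎_; inj₁; inj₂)
import Data.Sum.Properties as Sum
open import Data.Unit using (tt)
open import Function using (_∘_; id)
open import Function.Bundles using (_⇔_; mk⇔)
open import Function.Indexed.Relation.Binary.Equality using (≡-setoid)
open import Relation.Binary.Bundles using (Setoid)
open import Relation.Binary.Definitions using (DecidableEquality; _Respects_)
import Relation.Binary.Indexed.Heterogeneous.Construct.Trivial as Trivial
open import Relation.Binary.PropositionalEquality as ≡
  using (_≡_; _≢_; refl; sym; trans; cong; cong₂; subst; subst₂)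
open import Relation.Nullary using (Dec; yes; no; does; ¬_; contradiction)
open import Relation.Nullary.Decidable using (map′; _×-dec_; _⊎-dec_; _→-dec_; ¬?; dec-true)
open import Relation.Unary using (Pred; Decidable)
import Relation.Binary.Construct.On as On

-- Without function extensionality, functions and graphs can only be enumerated up to
-- pointwise equality; hence enumerations of setoids and predicates respecting them.
∀? : ∀ (S : Setoid 0ℓ 0ℓ) {xs} → IsEnumeration S xs →
     {P : Pred (Setoid.Carrier S) 0ℓ} → P Respects Setoid._≈_ S → Decidable P →
     Dec (∀ x → P x)
∀? S {xs} enum resp P? = map′ (λ ps x → All.lookupₛ S resp ps (enum x))
                              (λ ∀P → All.tabulate (λ _ → ∀P _))
                              (All.all? P? xs)

_⊕_ : ∀ {A B : Set} → List A → List B → List (A ⊎ B)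
xs ⊕ ys = map inj₁ xs ++ map inj₂ ys

⊕⁺ : ∀ {A B : Set} {xs : List A} {ys : List B} →
     (∀ x → x ∈ xs) → (∀ y → y ∈ ys) → ∀ z → z ∈ xs ⊕ ys
⊕⁺ enumˣ enumʸ (inj₁ x) = ∈-++⁺ˡ (∈-map⁺ inj₁ (enumˣ x))
⊕⁺ enumˣ enumʸ (inj₂ y) = ∈-++⁺ʳ _ (∈-map⁺ inj₂ (enumʸ y))

_⊗_ : ∀ {A B : Set} → List A → List B → List (A × B)
_⊗_ = cartesianProduct

⊗⁺ : ∀ {A B : Set} {xs : List A} {ys : List B} →
     (∀ x → x ∈ xs) → (∀ y → y ∈ ys) → ∀ z → z ∈ xs ⊗ ys
⊗⁺ enumˣ enumʸ (x , y) = ∈-cartesianProduct⁺ (enumˣ x) (enumʸ y)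

bools : List Bool
bools = true ∷ false ∷ []

bools⁺ : IsEnumeration (≡.setoid Bool) bools
bools⁺ true  = here refl
bools⁺ false = there (here refl)

_^_ : Setoid 0ℓ 0ℓ → ℕ → Setoid 0ℓ 0ℓ
S ^ k = ≡-setoid (Fin k) (Trivial.indexedSetoid S)

vectors : ∀ {A : Set} → List A → ∀ k → List (Vector A k)
vectors xs zero    = [ Vector.[] ]
vectors xs (suc k) = map (uncurry Vector._∷_) (xs ⊗ vectors xs k)

vectors⁺ : ∀ (S : Setoid 0ℓ 0ℓ) {xs} → IsEnumeration S xs →
           ∀ k → IsEnumeration (S ^ k) (vectors xs k)
vectors⁺ S enum zero    f = here (λ ())
vectors⁺ S enum (suc k) f =
  Setoidₘ.∈-resp-≈ (S ^ suc k) head∷tail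
    (Setoidₘ.∈-map⁺ (S ×ₛ (S ^ k)) (S ^ suc k) ∷-cong
      (cartesianProduct⁺ S (S ^ k) enum (vectors⁺ S enum k) (f zero , Vector.tail f)))
  where
  open Setoid S using (_≈_) renaming (refl to ≈-refl)
  head∷tail : ∀ i → (f zero Vector.∷ Vector.tail f) i ≈ f i
  head∷tail zero    = ≈-refl
  head∷tail (suc i) = ≈-refl
  ∷-cong : ∀ {p q} → Setoid._≈_ (S ×ₛ (S ^ k)) p q →
           ∀ i → (uncurry Vector._∷_ p) i ≈ (uncurry Vector._∷_ q) i
  ∷-cong (a≈b , f≈g) zero    = a≈b
  ∷-cong (a≈b , f≈g) (suc i) = f≈g i

subsets : ∀ n → List (Subset n)
subsets n = map tabulate (vectors bools n)

subsets⁺ : ∀ {n} (p : Subset n) → p ∈ subsets n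
subsets⁺ {n} p =
  subst (_∈ subsets n) (tabulate∘lookup p)
    (Setoidₘ.∈-map⁺ (≡.setoid Bool ^ n) (≡.setoid (Subset n)) tabulate-cong
      (vectors⁺ (≡.setoid Bool) bools⁺ n (lookup p)))

lists≤ : ∀ {A : Set} → List A → ℕ → List (List A)
lists≤ xs zero    = [ [] ]
lists≤ xs (suc N) = [] ∷ map (uncurry _∷_) (xs ⊗ lists≤ xs N)

∈-lists≤ : ∀ {A : Set} {xs : List A} → (∀ x → x ∈ xs) →
           ∀ N ys → length ys ℕ.≤ N → ys ∈ lists≤ xs N
∈-lists≤ enum zero    []       _          = here refl
∈-lists≤ enum (suc N) []       _          = here refl
∈-lists≤ enum (suc N) (y ∷ ys) (s≤s ys≤N) =
  there (∈-map⁺ (uncurry _∷_) (∈-cartesianProduct⁺ (enum y) (∈-lists≤ enum N ys ys≤N)))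

∃-bounded? : ∀ {A : Set} {xs : List A} → (∀ x → x ∈ xs) →
             ∀ N {P : Pred (List A) 0ℓ} → (∀ ys → P ys → length ys ℕ.≤ N) →
             Decidable P → Dec (∃ P)
∃-bounded? {xs = xs} enum N short P? =
  map′ Any.satisfied
       (λ (ys , pys) → Any.map (λ { refl → pys }) (∈-lists≤ enum N ys (short ys pys)))
       (Any.any? P? (lists≤ xs N))

matrixₛ : ℕ → Setoid 0ℓ 0ℓ
matrixₛ m = (≡.setoid Bool ^ m) ^ m

graphₛ : ℕ → Setoid 0ℓ 0ℓ
graphₛ m = On.setoid {B = Graph m} (matrixₛ m) adj

≟-sym : ∀ {m} (a b : Fin m) → does (a Fin.≟ b) ≡ does (b Fin.≟ a)
≟-sym a b with a Fin.≟ b | b Fin.≟ a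
... | yes _   | yes _   = refl
... | no _    | no _    = refl
... | yes a≡b | no b≢a  = contradiction (sym a≡b) b≢a
... | no a≢b  | yes b≡a = contradiction (sym b≡a) a≢b

symmetrise : ∀ {m} → (Fin m → Fin m → Bool) → Graph m
symmetrise M = record
  { adj   = λ a b → (M a b ∨ M b a) ∧ not (does (a Fin.≟ b))
  ; sym   = λ a b → cong₂ _∧_ (Bool.∨-comm (M a b) (M b a)) (cong not (≟-sym a b))
  ; irref = λ a → trans (cong (λ d → (M a a ∨ M a a) ∧ not d) (dec-true (a Fin.≟ a) refl))
                        (Bool.∧-zeroʳ _)
  }

symmetrise-adj : ∀ {m} (H : Graph m) a b → adj (symmetrise (adj H)) a b ≡ adj H a b
symmetrise-adj H a b with a Fin.≟ b
... | yes refl = trans (Bool.∧-zeroʳ _) (sym (irref H a))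
... | no _     = trans (Bool.∧-identityʳ _)
                       (trans (cong (adj H a b ∨_) (Graph.sym H b a)) (Bool.∨-idem _))

graphs : ∀ m → List (Graph m)
graphs m = map symmetrise (vectors (vectors bools m) m)

graphs⁺ : ∀ m → IsEnumeration (graphₛ m) (graphs m)
graphs⁺ m H =
  Setoidₘ.∈-resp-≈ (graphₛ m) {graphs m} {symmetrise (adj H)} {H} (symmetrise-adj H)
    (Setoidₘ.∈-map⁺ (matrixₛ m) (graphₛ m) {symmetrise} symmetrise-cong
      (vectors⁺ (≡.setoid Bool ^ m) (vectors⁺ (≡.setoid Bool) bools⁺ m) m (adj H)))
  where
  symmetrise-cong : ∀ {M M′} → Setoid._≈_ (matrixₛ m) M M′ →
                    Setoid._≈_ (graphₛ m) (symmetrise M) (symmetrise M′)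
  symmetrise-cong e a b = cong₂ (λ x y → (x ∨ y) ∧ not (does (a Fin.≟ b))) (e a b) (e b a)

adj? : ∀ {n} (G : Graph n) u v → Dec (Adj G u v)
adj? G u v = adj G u v Bool.≟ true

restrict : ∀ {m m′} → Graph m′ → (Fin m → Fin m′) → Graph m
restrict H ρ = record
  { adj   = λ a b → adj H (ρ a) (ρ b)
  ; sym   = λ a b → Graph.sym H (ρ a) (ρ b)
  ; irref = λ a → irref H (ρ a)
  }

Unique-lookup-injective : ∀ {n} {xs : List (Fin n)} → Unique xs →
                          ∀ i j → i Fin.< j → List.lookup xs i ≢ List.lookup xs j
Unique-lookup-injective (x∉xs AllPairs.∷ _) zero    (suc j) _         =
  All.lookup x∉xs (∈-lookup j)
Unique-lookup-injective (_    AllPairs.∷ u) (suc i) (suc j) (s≤s i<j) =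
  Unique-lookup-injective u i j i<j

Unique⇒length≤ : ∀ {n} {xs : List (Fin n)} → Unique xs → length xs ℕ.≤ n
Unique⇒length≤ {n} {xs} u with length xs ℕ.≤? n
... | yes ≤n = ≤n
... | no ≰n with i , j , i<j , eq ← Fin.pigeonhole (ℕ.≰⇒> ≰n) (List.lookup xs)
  = contradiction eq (Unique-lookup-injective u i j i<j)

punchIn-cancel-< : ∀ {m} (c : Fin (suc m)) {a b : Fin m} →
                   punchIn c a Fin.< punchIn c b → a Fin.< b
punchIn-cancel-< c {a} {b} ρa<ρb with a Fin.<? b
... | yes a<b = a<b
... | no a≮b  = contradiction ρa<ρb (ℕ.≤⇒≯ (Fin.punchIn-mono-≤ c b a (ℕ.≮⇒≥ a≮b)))

¬hits-all : ∀ {k m} → k ℕ.< m → (f : Fin k → Maybe (Fin m)) → ¬ (∀ c → ∃[ i ] f i ≡ just c)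
¬hits-all k<m f hit with c₁ , c₂ , c₁<c₂ , i₁≡i₂ ← Fin.pigeonhole k<m (proj₁ ∘ hit) =
  Fin.<⇒≢ c₁<c₂ (just-injective (begin
    just c₁            ≡⟨ sym (proj₂ (hit c₁)) ⟩
    f (proj₁ (hit c₁)) ≡⟨ cong f i₁≡i₂ ⟩
    f (proj₁ (hit c₂)) ≡⟨ proj₂ (hit c₂) ⟩
    just c₂            ∎))
  where open ≡.≡-Reasoning

∃-unhit : ∀ {k m} → k ℕ.< m → (f : Fin k → Maybe (Fin m)) → ∃[ c ] ∀ i → f i ≢ just c
∃-unhit {m = m} k<m f =
  let c , ¬hit-c = Fin.¬∀⟶∃¬ m _ hit? (¬hits-all k<m f)
  in c , λ i fi≡c → ¬hit-c (i , fi≡c)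
  where
  hit? : ∀ c → Dec (∃[ i ] f i ≡ just c)
  hit? c = Fin.any? λ i → ≡-dec-Maybe Fin._≟_ (f i) (just c)

mapPV : ∀ {n m m′} → (Fin m → Fin m′) → PV n m → PV n m′
mapPV ρ (v1 u a)   = v1 u (ρ a)
mapPV ρ (v2 u)     = v2 u
mapPV ρ (v3 u a)   = v3 u (ρ a)
mapPV ρ (v4 u a b) = v4 u (ρ a) (ρ b)

mapPV-id : ∀ {n m} (p : PV n m) → mapPV id p ≡ p
mapPV-id (v1 u a)   = refl
mapPV-id (v2 u)     = refl
mapPV-id (v3 u a)   = refl
mapPV-id (v4 u a b) = refl

pfst-mapPV : ∀ {n m m′} (ρ : Fin m → Fin m′) (p : PV n m) → pfst (mapPV ρ p) ≡ pfst p
pfst-mapPV ρ (v1 u a)   = refl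
pfst-mapPV ρ (v2 u)     = refl
pfst-mapPV ρ (v3 u a)   = refl
pfst-mapPV ρ (v4 u a b) = refl

labels : ∀ {n m} → PV n m → Fin 2 → Maybe (Fin m)
labels (v1 _ a)   _       = just a
labels (v2 _)     _       = nothing
labels (v3 _ a)   _       = just a
labels (v4 _ a b) zero    = just a
labels (v4 _ a b) (suc _) = just b

Misses : ∀ {n m} → Fin m → PV n m → Set
Misses c p = ∀ s → labels p s ≢ just c

∃-missed-label : ∀ {n m} → n ℕ.* 2 ℕ.< m → (h : Fin n → PV n m) → ∃[ c ] ∀ x → Misses c (h x)
∃-missed-label {n} 2n<m h with c , unhit ← ∃-unhit 2n<m (uncurry (labels ∘ h) ∘ Fin.remQuot 2) =
  c , λ x s → subst (λ (y , t) → labels (h y) t ≢ just c) (Fin.remQuot-combine x s)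
                    (unhit (Fin.combine x s))

unlabel : ∀ {n m} (c : Fin (suc m)) (p : PV n (suc m)) → Misses c p → PV n m
unlabel c (v1 u a)   miss = v1 u (punchOut (miss zero ∘ cong just ∘ sym))
unlabel c (v2 u)     miss = v2 u
unlabel c (v3 u a)   miss = v3 u (punchOut (miss zero ∘ cong just ∘ sym))
unlabel c (v4 u a b) miss =
  v4 u (punchOut (miss zero ∘ cong just ∘ sym)) (punchOut (miss (suc zero) ∘ cong just ∘ sym))

mapPV-unlabel : ∀ {n m} c (p : PV n (suc m)) miss → mapPV (punchIn c) (unlabel c p miss) ≡ p
mapPV-unlabel c (v1 u a)   miss = cong (v1 u) (Fin.punchIn-punchOut _)
mapPV-unlabel c (v2 u)     miss = refl
mapPV-unlabel c (v3 u a)   miss = cong (v3 u) (Fin.punchIn-punchOut _)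
mapPV-unlabel c (v4 u a b) miss = cong₂ (v4 u) (Fin.punchIn-punchOut _) (Fin.punchIn-punchOut _)

PV⊎ : ℕ → ℕ → Set
PV⊎ n m = (Fin n × Fin m) ⊎ Fin n ⊎ (Fin n × Fin m) ⊎ (Fin n × Fin m × Fin m)

toSum : ∀ {n m} → PV n m → PV⊎ n m
toSum (v1 u a)   = inj₁ (u , a)
toSum (v2 u)     = inj₂ (inj₁ u)
toSum (v3 u a)   = inj₂ (inj₂ (inj₁ (u , a)))
toSum (v4 u a b) = inj₂ (inj₂ (inj₂ (u , a , b)))

fromSum : ∀ {n m} → PV⊎ n m → PV n m
fromSum (inj₁ (u , a))                 = v1 u a
fromSum (inj₂ (inj₁ u))                = v2 u
fromSum (inj₂ (inj₂ (inj₁ (u , a))))   = v3 u a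
fromSum (inj₂ (inj₂ (inj₂ (u , a , b)))) = v4 u a b

fromSum-toSum : ∀ {n m} (p : PV n m) → fromSum (toSum p) ≡ p
fromSum-toSum (v1 u a)   = refl
fromSum-toSum (v2 u)     = refl
fromSum-toSum (v3 u a)   = refl
fromSum-toSum (v4 u a b) = refl

_≟PV_ : ∀ {n m} → DecidableEquality (PV n m)
p ≟PV q = map′ (λ e → trans (sym (fromSum-toSum p)) (trans (cong fromSum e) (fromSum-toSum q)))
               (cong toSum)
               (Sum.≡-dec pair? (Sum.≡-dec Fin._≟_ (Sum.≡-dec pair? (Σ.≡-dec Fin._≟_ pair?)))
                 (toSum p) (toSum q))
  where
  pair? : ∀ {k l} → DecidableEquality (Fin k × Fin l)
  pair? = Σ.≡-dec Fin._≟_ Fin._≟_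

allPV : ∀ n m → List (PV n m)
allPV n m = map fromSum (pairs ⊕ (allFin n ⊕ (pairs ⊕ (allFin n ⊗ (allFin m ⊗ allFin m)))))
  where
  pairs : List (Fin n × Fin m)
  pairs = allFin n ⊗ allFin m

allPV⁺ : ∀ n m → IsEnumeration (≡.setoid (PV n m)) (allPV n m)
allPV⁺ n m p = subst (_∈ allPV n m) (fromSum-toSum p) (∈-map⁺ fromSum (sums⁺ (toSum p)))
  where
  pairs⁺ : ∀ (z : Fin n × Fin m) → z ∈ allFin n ⊗ allFin m
  pairs⁺ = ⊗⁺ ∈-allFin ∈-allFin
  sums⁺ : ∀ (z : PV⊎ n m) → z ∈ _
  sums⁺ = ⊕⁺ pairs⁺ (⊕⁺ ∈-allFin (⊕⁺ pairs⁺ (⊗⁺ ∈-allFin (⊗⁺ ∈-allFin ∈-allFin))))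

module Decide {n : ℕ} (G : Graph n) (F D : Subset n) where

  kAdj? : ∀ u v → Dec (KAdj G F u v)
  kAdj? u v = adj? G u v ×-dec ¬? (u ∈? F) ×-dec ¬? (v ∈? F)

  dPath? : ∀ u v xs → Dec (DPath G F D u v xs)
  dPath? u v xs = linked? kAdj? _ ×-dec Unique.unique? Fin._≟_ _ ×-dec All.all? (_∈? D) xs

  DPath⇒length≤ : ∀ {u v} xs → DPath G F D u v xs → length xs ℕ.≤ n
  DPath⇒length≤ {u} {v} xs (_ , unique , _) = begin
    length xs                 ≤⟨ List.length-++-≤ˡ xs ⟩
    length (xs ++ [ v ])      ≤⟨ ℕ.n≤1+n _ ⟩
    length (u ∷ xs ++ [ v ])  ≤⟨ Unique⇒length≤ unique ⟩
    n                         ∎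
    where open ℕ.≤-Reasoning

  qVert? : ∀ v → Dec (QVert F D v)
  qVert? v = ¬? (v ∈? F) ×-dec ¬? (v ∈? D)

  dPathThrough? : ∀ x v w → Dec (∃[ xs ] (DPath G F D v w xs × x ∈ (v ∷ xs ++ [ w ])))
  dPathThrough? x v w =
    ∃-bounded? ∈-allFin n (λ xs → DPath⇒length≤ xs ∘ proj₁)
               (λ xs → dPath? v w xs ×-dec Any.any? (x Fin.≟_) (v ∷ xs ++ [ w ]))

  assocV? : ∀ x v → Dec (AssocV G F D x v)
  assocV? x v = (x ∈? D) ×-dec qVert? v ×-dec
    Fin.any? (λ w → (w ∈? D) ×-dec (degK G F w ℕ.≟ 1) ×-dec dPathThrough? x v w)

  assocE? : ∀ x v w → Dec (AssocE G F D x v w)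
  assocE? x v w = (x ∈? D) ×-dec qVert? v ×-dec qVert? w ×-dec dPathThrough? x v w

  module _ {m : ℕ} (H : Graph m) (χ : Fin m → Fin n) where
    open Product G F D H χ

    validP? : ∀ p → Dec (ValidP p)
    validP? (v1 u a)   = χ a Fin.≟ u
    validP? (v2 u)     = (u ∈? F) ⊎-dec ((u ∈? D) ×-dec
                           ¬? (Fin.any? (assocV? u)) ×-dec
                           ¬? (Fin.any? (λ v → Fin.any? (assocE? u v))))
    validP? (v3 u a)   = (u ∈? D) ×-dec assocV? u (χ a)
    validP? (v4 u a b) = (a Fin.<? b) ×-dec adj? H a b ×-dec (u ∈? D) ×-dec assocE? u (χ a) (χ b)

    pAdj′? : ∀ p q → Dec (PAdj' p q)
    pAdj′? (v1 _ a)   (v1 _ b)   = adj? H a b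
    pAdj′? (v1 _ _)   (v2 _)     = yes tt
    pAdj′? (v1 _ a)   (v3 _ b)   = a Fin.≟ b
    pAdj′? (v1 _ a)   (v4 _ b c) = (a Fin.≟ b) ⊎-dec (a Fin.≟ c)
    pAdj′? (v2 _)     (v1 _ _)   = yes tt
    pAdj′? (v2 _)     (v2 _)     = yes tt
    pAdj′? (v2 _)     (v3 _ _)   = yes tt
    pAdj′? (v2 _)     (v4 _ _ _) = yes tt
    pAdj′? (v3 _ a)   (v1 _ b)   = b Fin.≟ a
    pAdj′? (v3 _ _)   (v2 _)     = yes tt
    pAdj′? (v3 _ a)   (v3 _ b)   = a Fin.≟ b
    pAdj′? (v3 _ _)   (v4 _ _ _) = no λ ()
    pAdj′? (v4 _ b c) (v1 _ a)   = (a Fin.≟ b) ⊎-dec (a Fin.≟ c)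
    pAdj′? (v4 _ _ _) (v2 _)     = yes tt
    pAdj′? (v4 _ _ _) (v3 _ _)   = no λ ()
    pAdj′? (v4 _ a b) (v4 _ c d) = (a Fin.≟ c) ×-dec (b Fin.≟ d)

    isEmbedding? : ∀ h → Dec (IsEmbedding h)
    isEmbedding? h =
      Fin.all? (λ x → validP? (h x)) ×-dec
      Fin.all? (λ x → Fin.all? λ y → (h x ≟PV h y) →-dec (x Fin.≟ y)) ×-dec
      Fin.all? (λ x → Fin.all? λ y → adj? G x y →-dec
                        (adj? G (pfst (h x)) (pfst (h y)) ×-dec pAdj′? (h x) (h y)))

  isFrame? : Dec (IsFrame G F)
  isFrame? = ∀? (≡.setoid (Fin n) ^ n) (vectors⁺ (≡.setoid (Fin n)) ∈-allFin n) frame-resp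
      (λ h → isEndo? h →-dec hits? h →-dec Fin.all? (λ w → Fin.any? λ v → h v Fin.≟ w))
    where
    isEndo? : ∀ h → Dec (IsEndo G h)
    isEndo? h = Fin.all? λ u → Fin.all? λ v → adj? G u v →-dec adj? G (h u) (h v)
    hits? : ∀ (h : Fin n → Fin n) → Dec (∀ u → u Subset.∈ F → ∃[ v ] h v ≡ u)
    hits? h = Fin.all? λ u → (u ∈? F) →-dec Fin.any? λ v → h v Fin.≟ u
    frame-resp : ∀ {h h′} → (∀ x → h x ≡ h′ x) →
      (IsEndo G h → (∀ u → u Subset.∈ F → ∃[ v ] h v ≡ u) → Surjective h) →
      (IsEndo G h′ → (∀ u → u Subset.∈ F → ∃[ v ] h′ v ≡ u) → Surjective h′)
    frame-resp h≗h′ frame endo′ hits′ w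
      with v , hv≡w ← frame (λ u v uv → subst₂ (Adj G) (sym (h≗h′ u)) (sym (h≗h′ v))
                                                     (endo′ u v uv))
                            (λ u u∈F → let v , h′v≡u = hits′ u u∈F in v , trans (h≗h′ v) h′v≡u)
                            w
      = v , trans (sym (h≗h′ v)) hv≡w

  isSkeleton? : Dec (IsSkeleton G F D)
  isSkeleton? = isFrame? ×-dec Fin.all? (λ u → (u ∈? F) →-dec ¬? (u ∈? D))
                         ×-dec Fin.all? (λ v → (v ∈? D) →-dec (degK G F v ℕ.≤? 2))

module Relabel {n m m′ : ℕ} (G : Graph n) (F D : Subset n)
               {H : Graph m} {H′ : Graph m′} {χ : Fin m → Fin n} {χ′ : Fin m′ → Fin n}
               (ρ : Fin m → Fin m′)
               (ρ-injective : ∀ {a b} → ρ a ≡ ρ b → a ≡ b)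
               (ρ-cancel-< : ∀ {a b} → ρ a Fin.< ρ b → a Fin.< b)
               (adj-ρ : ∀ a b → adj H a b ≡ adj H′ (ρ a) (ρ b))
               (χ-ρ : ∀ a → χ a ≡ χ′ (ρ a)) where

  module P  = Product G F D H χ
  module P′ = Product G F D H′ χ′

  ValidP-reflect : ∀ p → P′.ValidP (mapPV ρ p) → P.ValidP p
  ValidP-reflect (v1 u a)   χ′ρa≡u                   = trans (χ-ρ a) χ′ρa≡u
  ValidP-reflect (v2 u)     valid                    = valid
  ValidP-reflect (v3 u a)   (u∈D , assoc)            =
    u∈D , subst (AssocV G F D u) (sym (χ-ρ a)) assoc
  ValidP-reflect (v4 u a b) (ρa<ρb , ab , u∈D , assoc) =
    ρ-cancel-< ρa<ρb , trans (adj-ρ a b) ab , u∈D ,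
    subst₂ (AssocE G F D u) (sym (χ-ρ a)) (sym (χ-ρ b)) assoc

  PAdj′-reflect : ∀ p q → P′.PAdj' (mapPV ρ p) (mapPV ρ q) → P.PAdj' p q
  PAdj′-reflect (v1 _ a)   (v1 _ b)   ab             = trans (adj-ρ a b) ab
  PAdj′-reflect (v1 _ _)   (v2 _)     _              = tt
  PAdj′-reflect (v1 _ _)   (v3 _ _)   eq             = ρ-injective eq
  PAdj′-reflect (v1 _ _)   (v4 _ _ _) (inj₁ eq)      = inj₁ (ρ-injective eq)
  PAdj′-reflect (v1 _ _)   (v4 _ _ _) (inj₂ eq)      = inj₂ (ρ-injective eq)
  PAdj′-reflect (v2 _)     (v1 _ _)   _              = tt
  PAdj′-reflect (v2 _)     (v2 _)     _              = tt
  PAdj′-reflect (v2 _)     (v3 _ _)   _              = tt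
  PAdj′-reflect (v2 _)     (v4 _ _ _) _              = tt
  PAdj′-reflect (v3 _ _)   (v1 _ _)   eq             = ρ-injective eq
  PAdj′-reflect (v3 _ _)   (v2 _)     _              = tt
  PAdj′-reflect (v3 _ _)   (v3 _ _)   eq             = ρ-injective eq
  PAdj′-reflect (v4 _ _ _) (v1 _ _)   (inj₁ eq)      = inj₁ (ρ-injective eq)
  PAdj′-reflect (v4 _ _ _) (v1 _ _)   (inj₂ eq)      = inj₂ (ρ-injective eq)
  PAdj′-reflect (v4 _ _ _) (v2 _)     _              = tt
  PAdj′-reflect (v4 _ _ _) (v4 _ _ _) (eq₁ , eq₂)    = ρ-injective eq₁ , ρ-injective eq₂

  IsEmbedding-reflect : ∀ {h h′} → (∀ x → mapPV ρ (h x) ≡ h′ x) →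
                        P′.IsEmbedding h′ → P.IsEmbedding h
  IsEmbedding-reflect {h} {h′} ρh≗h′ (valid , injective , hom) =
    (λ x → ValidP-reflect (h x) (subst P′.ValidP (sym (ρh≗h′ x)) (valid x))) ,
    (λ x y hx≡hy →
       injective x y (trans (sym (ρh≗h′ x)) (trans (cong (mapPV ρ) hx≡hy) (ρh≗h′ y)))) ,
    (λ x y xy → let G-adj , adj′ = subst₂ P′.PAdj (sym (ρh≗h′ x)) (sym (ρh≗h′ y)) (hom x y xy)
                in subst₂ (Adj G) (pfst-mapPV ρ (h x)) (pfst-mapPV ρ (h y)) G-adj ,
                   PAdj′-reflect (h x) (h y) adj′)

module Rigidity {n : ℕ} (G : Graph n) (F D : Subset n) where
  open Decide G F D

  Pinned : ∀ {m} → (Fin n → PV n m) → Set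
  Pinned h = ∀ u → u Subset.∈ F → ∃[ x ] h x ≡ v2 u

  RigidFor : ∀ {m} → Graph m → (Fin m → Fin n) → Set
  RigidFor H χ = ∀ h → Product.IsEmbedding G F D H χ h → Pinned h

  RigidAt : ℕ → Set
  RigidAt m = ∀ (H : Graph m) (χ : Fin m → Fin n) → (∀ a → QVert F D (χ a)) → RigidFor H χ

  pinned? : ∀ {m} (h : Fin n → PV n m) → Dec (Pinned h)
  pinned? h = Fin.all? λ u → (u ∈? F) →-dec Fin.any? λ x → h x ≟PV v2 u

  Pinned-mapPV : ∀ {m m′} (ρ : Fin m → Fin m′) {h h′} → (∀ x → mapPV ρ (h x) ≡ h′ x) →
                 Pinned h → Pinned h′
  Pinned-mapPV ρ ρh≗h′ pinned u u∈F with x , hx≡u ← pinned u u∈F =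
    x , trans (sym (ρh≗h′ x)) (cong (mapPV ρ) hx≡u)

  IsEmbedding-resp : ∀ {m} {H H′ : Graph m} {χ χ′ h h′} →
    (∀ a b → adj H a b ≡ adj H′ a b) → (∀ a → χ a ≡ χ′ a) → (∀ x → h x ≡ h′ x) →
    Product.IsEmbedding G F D H′ χ′ h′ → Product.IsEmbedding G F D H χ h
  IsEmbedding-resp {h = h} H≈H′ χ≗χ′ h≗h′ =
    Relabel.IsEmbedding-reflect G F D id id id H≈H′ χ≗χ′ (λ x → trans (mapPV-id (h x)) (h≗h′ x))

  rigidAt? : ∀ m → Dec (RigidAt m)
  rigidAt? m =
    ∀? (graphₛ m) (graphs⁺ m) graph-resp λ H →
    ∀? (≡.setoid (Fin n) ^ m) (vectors⁺ (≡.setoid (Fin n)) ∈-allFin m) labelling-resp λ χ →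
    Fin.all? (qVert? ∘ χ) →-dec
    ∀? (≡.setoid (PV n m) ^ n) (vectors⁺ (≡.setoid (PV n m)) (allPV⁺ n m) n) map-resp λ h →
    isEmbedding? H χ h →-dec pinned? h
    where
    graph-resp : ∀ {H H′} → (∀ a b → adj H a b ≡ adj H′ a b) →
                 (∀ χ → (∀ a → QVert F D (χ a)) → RigidFor H χ) →
                 (∀ χ → (∀ a → QVert F D (χ a)) → RigidFor H′ χ)
    graph-resp H≈H′ rigid χ qv h emb =
      rigid χ qv h (IsEmbedding-resp H≈H′ (λ _ → refl) (λ _ → refl) emb)
    labelling-resp : ∀ {H : Graph m} {χ χ′} → (∀ a → χ a ≡ χ′ a) →
                     ((∀ a → QVert F D (χ a)) → RigidFor H χ) →
                     ((∀ a → QVert F D (χ′ a)) → RigidFor H χ′)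
    labelling-resp χ≗χ′ rigid qv′ h emb =
      rigid (λ a → subst (QVert F D) (sym (χ≗χ′ a)) (qv′ a)) h
            (IsEmbedding-resp (λ _ _ → refl) χ≗χ′ (λ _ → refl) emb)
    map-resp : ∀ {H : Graph m} {χ h h′} → (∀ x → h x ≡ h′ x) →
               (Product.IsEmbedding G F D H χ h → Pinned h) →
               (Product.IsEmbedding G F D H χ h′ → Pinned h′)
    map-resp {h = h} h≗h′ rigid emb′ =
      Pinned-mapPV id (λ x → trans (mapPV-id (h x)) (h≗h′ x))
        (rigid (IsEmbedding-resp (λ _ _ → refl) (λ _ → refl) h≗h′ emb′))

  restrict-rigidFor⇒pinned : ∀ {m} {H : Graph (suc m)} {χ} c {h} (miss : ∀ x → Misses c (h x)) →
    RigidFor (restrict H (punchIn c)) (χ ∘ punchIn c) →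
    Product.IsEmbedding G F D H χ h → Pinned h
  restrict-rigidFor⇒pinned c {h} miss rigid emb =
    Pinned-mapPV (punchIn c) unlabel-lifts
      (rigid (λ x → unlabel c (h x) (miss x))
        (Relabel.IsEmbedding-reflect G F D (punchIn c) (Fin.punchIn-injective c _ _)
           (punchIn-cancel-< c) (λ _ _ → refl) (λ _ → refl) unlabel-lifts emb))
    where
    unlabel-lifts : ∀ x → mapPV (punchIn c) (unlabel c (h x) (miss x)) ≡ h x
    unlabel-lifts x = mapPV-unlabel c (h x) (miss x)

  rigidAt-suc : ∀ {m} → n ℕ.* 2 ℕ.< suc m → RigidAt m → RigidAt (suc m)
  rigidAt-suc 2n<m rigid H χ qv h emb =
    let c , miss = ∃-missed-label 2n<m h
    in restrict-rigidFor⇒pinned c miss (rigid (restrict H (punchIn c)) (χ ∘ punchIn c) (qv ∘ punchIn c)) emb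

  rigidAt-all : (∀ {m} → m ℕ.< suc (n ℕ.* 2) → RigidAt m) → ∀ m → RigidAt m
  rigidAt-all small zero = small (s≤s z≤n)
  rigidAt-all small (suc m) with suc m ℕ.<? suc (n ℕ.* 2)
  ... | yes m<2n+1 = small m<2n+1
  ... | no  m≮2n+1 = rigidAt-suc (ℕ.≮⇒≥ m≮2n+1) (rigidAt-all small m)

  rigid? : Dec (∀ m → RigidAt m)
  rigid? = map′ rigidAt-all (λ rigid _ → rigid _) (ℕ.allUpTo? rigidAt? (suc (n ℕ.* 2)))

  isRigidSkeleton? : Dec (IsRigidSkeleton G F D)
  isRigidSkeleton? = isSkeleton? ×-dec rigid?

proposition4p13 : (n : ℕ) (G : Graph n) →
    Σ (List (Subset n × Subset n)) (λ L →
      (F D : Subset n) → ((F , D) ∈ L) ⇔ IsRigidSkeleton G F D)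
proposition4p13 n G =
  List.filter rigidSkeleton? (subsets n ⊗ subsets n) ,
  λ F D → mk⇔ (proj₂ ∘ ∈-filter⁻ rigidSkeleton? {xs = subsets n ⊗ subsets n})
              (∈-filter⁺ rigidSkeleton? (⊗⁺ subsets⁺ subsets⁺ (F , D)))
  where
  rigidSkeleton? : ∀ ((F , D) : Subset n × Subset n) → Dec (IsRigidSkeleton G F D)
  rigidSkeleton? (F , D) = Rigidity.isRigidSkeleton? G F D
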